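{- Let $\mathbb{F}_q$ be a finite field. Let $W$ be a weighing matrix $\mathrm{W}(n,m)$ and let $G$ be a permutation automorphism group of $W$ acting with $t$ orbits on the rows and $t$ orbits on the columns of $W$, all of the same length. Let $B$ be the $t\times b$ point-by-block incidence matrix of an $(r,\lambda)$-design, and let $R$ be the row orbit matrix of $W$ with respect to $G$. If $r+(t-1)\lambda+m\neq 0$ and $r-\lambda+m\neq 0$ in $\mathbb{F}_q$, then $A=[\,R\mid B\,]$ (with entries interpreted in $\mathbb{F}_q$) generates an LCD code $C$ of length $t+b$ over $\mathbb{F}_q$.
   Context: A weighing matrix $\mathrm{W}(n,m)$ is an $n\times n$ matrix $W$ with entries in $\{0,1,-1\}$ such that $WW^{\top}=mI_n$ over $\mathbb{C}$. A permutation automorphism of an $n\times n$ matrix $M$ is a pair $(P,Q)$ of permutation matrices with $PMQ^{\top}=M$; these form a group $\mathrm{PAut}(M)$ under $(P,Q)(R,S)=(PR,QS)$, and a permutation automorphism group of $M$ is a subgroup $G\le\mathrm{PAut}(M)$; it acts on the rows of $M$ (via $P$) and on the columns of $M$ (via $Q$). Let $\mathcal{R}_1,\dots,\mathcal{R}_t$ and $\mathcal{C}_1,\dots,\mathcal{C}_t$ be the $G$-orbits on rows and columns, and let $M_{ij}$ be the submatrix of $M$ with rows in $\mathcal{R}_i$ and columns in $\mathcal{C}_j$. All rows of $M_{ij}$ have the same sum $\Gamma_{ij}$; the row orbit matrix of $M$ with respect to $G$ is the $t\times t$ matrix $R=[\Gamma_{ij}]$. An $(r,\lambda)$-design is a finite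 set of points with a collection of $b$ subsets (blocks) such that each point lies in exactly $r$ blocks and every pair of distinct points lies together in exactly $\lambda$ blocks; its point-by-block incidence matrix is the $(0,1)$-matrix with rows indexed by points, columns by blocks, and entry $1$ exactly when the point lies in the block. Integers are interpreted in $\mathbb{F}_q$. A matrix over $\mathbb{F}_q$ generates the linear code spanned by its rows. For a linear code $C\subseteq\mathbb{F}_q^N$, $C^\perp$ is its orthogonal complement under the standard inner product, and $C$ is LCD if $C\cap C^\perp=\{0\}$. -}

module Defs where

open import Level using (_⊔_; suc; 0ℓ)
open import Algebra.Bundles using (CommutativeRing)
import Algebra.Definitions.RawMonoid as RawMonoidDefs
import Algebra.Properties.Semiring.Sum as SemiringSum
open import Data.Bool.Base using (if_then_else_)
open import Data.Nat.Base as ℕ using (ℕ)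
open import Data.Integer.Base as ℤ using (ℤ; +_; -[1+_]; 0ℤ; 1ℤ; -1ℤ)
import Data.Integer.Properties as ℤₚ
open import Data.Fin.Base using (Fin)
open import Data.Fin.Properties using (_≟_)
open import Data.Fin.Permutation using (Permutation′; _⟨$⟩ʳ_)
open import Data.Fin.Subset using (Subset; _∈_)
open import Data.Fin.Subset.Properties using (_∈?_)
open import Data.Vec.Base using (Vec; lookup; count)
open import Data.Vec.Functional using (Vector; _++_; map)
open import Data.Product.Base using (_×_; _,_; ∃; ∃₂; ∃-syntax)
open import Data.Sum.Base using (_⊎_)
open import Function.Bundles using (Inverse; _⇔_)
open import Function.Definitions using (Injective)
open import Relation.Binary.Core using (Rel)
open import Relation.Binary.PropositionalEquality as ≡ using (_≡_; _≢_)
open import Relation.Nullary.Decidable using (does; _×-dec_)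
open import Relation.Unary using (Pred)

Matrix : ∀ {a} → Set a → ℕ → ℕ → Set a
Matrix A m n = Vector (Vector A n) m

open SemiringSum (CommutativeRing.semiring ℤₚ.+-*-commutativeRing)
  using () renaming (sum to sumℤ) public

infix  4 _≋_
infixl 7 _⊗_
infixl 8 _ᵀ

_≋_ : ∀ {m n} → Rel (Matrix ℤ m n) 0ℓ
M ≋ N = ∀ i j → M i j ≡ N i j

_⊗_ : ∀ {l m n} → Matrix ℤ l m → Matrix ℤ m n → Matrix ℤ l n
(M ⊗ N) i k = sumℤ λ j → M i j ℤ.* N j k

_ᵀ : ∀ {a} {A : Set a} {m n} → Matrix A m n → Matrix A n m
(M ᵀ) i j = M j i

I : ∀ n → Matrix ℤ n n
I n i j = if does (i ≟ j) then 1ℤ else 0ℤ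

_∣∣_ : ∀ {a} {A : Set a} {m n p} → Matrix A m n → Matrix A m p → Matrix A m (n ℕ.+ p)
(M ∣∣ N) i = M i ++ N i

record IsWeighingMatrix {n : ℕ} (W : Matrix ℤ n n) (m : ℕ) : Set where
  field
    entries    : ∀ i j → W i j ≡ 0ℤ ⊎ W i j ≡ 1ℤ ⊎ W i j ≡ -1ℤ
    orthogonal : W ⊗ W ᵀ ≋ λ i j → + m ℤ.* I n i j

IsPermutationMatrix : ∀ {n} → Matrix ℤ n n → Set
IsPermutationMatrix {n} P = ∃ λ (σ : Permutation′ n) → P ≋ λ i j → I n (σ ⟨$⟩ʳ i) j

record IsPermutationAutomorphism {n} (M P Q : Matrix ℤ n n) : Set where
  field
    isPermutationˡ : IsPermutationMatrix P
    isPermutationʳ : IsPermutationMatrix Q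
    preserves      : P ⊗ M ⊗ Q ᵀ ≋ M

-- G is a subgroup of PAut(M).  Matrices are compared entrywise, so G has to
-- be closed under _≋_; the inverse of a permutation matrix is its transpose.
record IsPermutationAutomorphismGroup
  {g n} (M : Matrix ℤ n n) (G : Matrix ℤ n n → Matrix ℤ n n → Set g) : Set g where
  field
    automorphism : ∀ {P Q} → G P Q → IsPermutationAutomorphism M P Q
    respects     : ∀ {P P′ Q Q′} → P ≋ P′ → Q ≋ Q′ → G P Q → G P′ Q′
    identity     : G (I n) (I n)
    product      : ∀ {P Q R S} → G P Q → G R S → G (P ⊗ R) (Q ⊗ S)
    inverse      : ∀ {P Q} → G P Q → G (P ᵀ) (Q ᵀ)

-- Left multiplication by P moves row x to position y precisely when
-- P y x = 1; right multiplication by Q ᵀ moves column x to position y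
-- precisely when Q y x = 1.
module _ {g n} (G : Matrix ℤ n n → Matrix ℤ n n → Set g) where

  RowMove ColumnMove : Rel (Fin n) g
  RowMove    x y = ∃₂ λ P Q → G P Q × P y x ≡ 1ℤ
  ColumnMove x y = ∃₂ λ P Q → G P Q × Q y x ≡ 1ℤ

-- A list without repetition of all the orbits, t in number, of an action
-- on Fin n in which x can be moved to y precisely when x ↝ y.
record Orbits {g n} (_↝_ : Rel (Fin n) g) (t : ℕ) : Set g where
  field
    orbit    : Fin t → Subset n
    rep      : Fin t → Fin n
    orbit-of : ∀ i x → x ∈ orbit i ⇔ rep i ↝ x
    cover    : ∀ x → ∃[ i ] x ∈ orbit i
    distinct : Injective _≡_ _≡_ orbit

open Orbits public using (orbit; rep)

-- Γᵢⱼ is the common row sum of the submatrix of M on the i-th row orbit and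
-- the j-th column orbit, read off at the row rep i.
rowOrbitMatrix : ∀ {g n t} {_↝ʳ_ _↝ᶜ_ : Rel (Fin n) g} →
                 Matrix ℤ n n → Orbits _↝ʳ_ t → Orbits _↝ᶜ_ t → Matrix ℤ t t
rowOrbitMatrix M rows columns i j =
  sumℤ λ y → if does (y ∈? orbit columns j) then M (rep rows i) y else 0ℤ

-- An (r,λ)-design on the point set Fin t; blocks may be repeated.
record IsDesign {t b : ℕ} (blocks : Vec (Subset t) b) (r lam : ℕ) : Set where
  field
    replication : ∀ p → count (p ∈?_) blocks ≡ r
    balance     : ∀ {p q} → p ≢ q →
                  count (λ β → (p ∈? β) ×-dec (q ∈? β)) blocks ≡ lam

incidenceMatrix : ∀ {t b} → Vec (Subset t) b → Matrix ℤ t b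
incidenceMatrix blocks p j = if does (p ∈? lookup blocks j) then 1ℤ else 0ℤ

record IsFiniteField {c ℓ} (F : CommutativeRing c ℓ) (q : ℕ) : Set (c ⊔ ℓ) where
  open CommutativeRing F
  field
    1≉0         : 1# ≉ 0#
    invertible  : ∀ x → x ≉ 0# → ∃[ y ] x * y ≈ 1#
    enumeration : Inverse setoid (≡.setoid (Fin q))

module Coding {c ℓ} (F : CommutativeRing c ℓ) where

  open CommutativeRing F
  open RawMonoidDefs +-rawMonoid using () renaming (_×_ to _·_)
  open SemiringSum semiring
    using (sum; sum-cong-≋; *-distribˡ-sum; ∑-distrib-+; sum-replicate-zero)

  fromℤ : ℤ → Carrier
  fromℤ (+ n)    = n · 1#
  fromℤ -[1+ n ] = - (ℕ.suc n · 1#)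

  fromℤ-matrix : ∀ {m n} → Matrix ℤ m n → Matrix Carrier m n
  fromℤ-matrix = map (map fromℤ)

  record LinearCode (N : ℕ) p : Set (c ⊔ ℓ ⊔ suc p) where
    field
      Codeword  : Pred (Vector Carrier N) p
      respects  : ∀ {u v} → (∀ j → u j ≈ v j) → Codeword u → Codeword v
      null      : Codeword (λ _ → 0#)
      plus      : ∀ {u v} → Codeword u → Codeword v → Codeword (λ j → u j + v j)
      scale     : ∀ a {u} → Codeword u → Codeword (λ j → a * u j)

  open LinearCode public using (Codeword)

  generatedBy : ∀ {k N} → Matrix Carrier k N → LinearCode N (c ⊔ ℓ)
  generatedBy {k} A = record
    { Codeword = λ v → ∃ λ (a : Vector Carrier k) → ∀ j → v j ≈ sum λ i → a i * A i j
    ; respects = λ u≈v (a , eq) → a , λ j → trans (sym (u≈v j)) (eq j)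
    ; null     = (λ _ → 0#) , λ j →
        sym (trans (sum-cong-≋ {k} (λ i → zeroˡ (A i j))) (sum-replicate-zero k))
    ; plus     = λ (a , eq) (a′ , eq′) → (λ i → a i + a′ i) , λ j →
        trans (+-cong (eq j) (eq′ j))
        (trans (sym (∑-distrib-+ (λ i → a i * A i j) (λ i → a′ i * A i j)))
               (sum-cong-≋ {k} (λ i → sym (distribʳ (A i j) (a i) (a′ i)))))
    ; scale    = λ s (a , eq) → (λ i → s * a i) , λ j →
        trans (*-congˡ (eq j))
        (trans (*-distribˡ-sum s (λ i → a i * A i j))
               (sum-cong-≋ {k} (λ i → sym (*-assoc s (a i) (A i j)))))
    }

  ⟨_,_⟩ : ∀ {N} → Vector Carrier N → Vector Carrier N → Carrier
  ⟨ u , v ⟩ = sum λ j → u j * v j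

  Dual : ∀ {N p} → LinearCode N p → Pred (Vector Carrier N) (c ⊔ ℓ ⊔ p)
  Dual C v = ∀ u → Codeword C u → ⟨ u , v ⟩ ≈ 0#

  LCD : ∀ {N p} → LinearCode N p → Set (c ⊔ ℓ ⊔ p)
  LCD C = ∀ v → (Codeword C v × Dual C v) ⇔ (∀ j → v j ≈ 0#)

{-# OPTIONS --safe #-}

-- By double counting and the equality of all orbit lengths, the column sums
-- of the block of W on the i-th row orbit and the j-th column orbit are equal
-- to its row sums Γᵢⱼ, so R Rᵀ = m I follows from W Wᵀ = m I. Since
-- B Bᵀ = (r − λ) I + λ J, the Gram matrix is A Aᵀ = (r − λ + m) I + λ J.
-- A codeword v = a A in the dual code satisfies a A Aᵀ = 0, that is
-- (r − λ + m) aₖ + λ s = 0 for all k, where s is the sum of the aᵢ. Summing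
-- over k gives (r + (t − 1) λ + m) s = 0, so s = 0, then a = 0 and v = 0.

module Submission where

open import Defs
open import Level using (Level)
open import Algebra.Bundles using (CommutativeRing)
import Algebra.Properties.AbelianGroup as AbelianGroupProperties
import Algebra.Properties.Ring as RingProperties
import Algebra.Properties.Semiring.Mult as SemiringMult
import Algebra.Properties.Semiring.Sum as SemiringSum
open import Data.Bool.Base using (true; false; if_then_else_)
open import Data.Nat.Base as ℕ using (ℕ; zero; suc)
import Data.Nat.Properties as ℕₚ
open import Data.Integer.Base using (ℤ; +_; -[1+_]; 0ℤ; 1ℤ; _⊖_; _+_; _-_; _*_; -_)
import Data.Integer.Properties as ℤₚ
open import Data.Integer.Solver using (module +-*-Solver)
open import Data.Fin.Base using (Fin; zero; suc; splitAt)
open import Data.Fin.Properties using (_≟_)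
open import Data.Fin.Permutation using (Permutation′; _⟨$⟩ʳ_)
open import Data.Fin.Subset using (Subset; ∣_∣; _∈_; inside)
open import Data.Fin.Subset.Properties using (_∈?_; ⊆-antisym; x∈p⇒∣p-x∣<∣p∣)
open import Data.Bool.Properties using () renaming (_≟_ to _≟ᵇ_)
open import Data.Product.Base using (_×_; _,_; proj₁; proj₂)
open import Data.Sum.Base using (inj₁; inj₂)
open import Data.Vec.Base using (Vec; []; _∷_; lookup; count)
open import Data.Vec.Properties using ([]=⇒lookup; lookup⇒[]=)
open import Data.Vec.Functional using (Vector; _++_)
open import Function.Base using (_∘_)
open import Function.Bundles using (_⇔_; mk⇔; Equivalence)
open import Relation.Binary.Core using (Rel)
open import Relation.Binary.Structures using (IsEquivalence)
open import Relation.Binary.PropositionalEquality as ≡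
  using (_≡_; _≢_; refl; cong; cong₂; subst; module ≡-Reasoning)
import Relation.Binary.Reasoning.Setoid as SetoidReasoning
open import Relation.Nullary.Decidable using (Dec; yes; no; does; does-⇔; dec-true; dec-false; _×-dec_)
open import Relation.Nullary.Negation using (¬_)
open import Relation.Unary using (Pred; Decidable)

private
  variable
    p q g : Level
    P Q : Set p
    n t : ℕ

-- Finite sums in a commutative ring

module Sum {c ℓ} (R : CommutativeRing c ℓ) where

  open CommutativeRing R
    renaming ( _+_ to _⊕_; _*_ to _⊛_; zero to *-zero
             ; refl to ≈-refl; sym to ≈-sym; trans to ≈-trans )
  open SemiringSum semiring public
  open SetoidReasoning setoid

  sum-zero : (f : Vector Carrier n) → (∀ i → f i ≈ 0#) → sum f ≈ 0#
  sum-zero {n} f f≈0 = ≈-trans (sum-cong-≋ f≈0) (sum-replicate-zero n)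

  sum-single : (i : Fin n) (f : Vector Carrier n) → (∀ j → i ≢ j → f j ≈ 0#) → sum f ≈ f i
  sum-single zero    f f≈0 =
    ≈-trans (+-congˡ (sum-zero (f ∘ suc) λ j → f≈0 (suc j) λ ())) (+-identityʳ _)
  sum-single (suc i) f f≈0 =
    ≈-trans (+-cong (f≈0 zero λ ()) (sum-single i (f ∘ suc) λ j i≢j → f≈0 (suc j) λ { refl → i≢j refl }))
            (+-identityˡ _)

  -- Both sides are the bilinear form of `a` and `b` with matrix `f`. Indicator weights make this an
  -- interchange of sums over subsets; general weights make it the reassociation of a product
  -- vector, matrix, vector.
  sum-*-comm : ∀ {l} (a : Vector Carrier n) (b : Vector Carrier l) (f : Fin n → Fin l → Carrier) →
               sum (λ i → a i ⊛ sum λ j → b j ⊛ f i j) ≈ sum λ j → b j ⊛ sum λ i → a i ⊛ f i j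
  sum-*-comm a b f = begin
    (sum λ i → a i ⊛ sum λ j → b j ⊛ f i j)   ≈⟨ sum-cong-≋ (λ i → *-distribˡ-sum (a i) (λ j → b j ⊛ f i j)) ⟩
    (sum λ i → sum λ j → a i ⊛ (b j ⊛ f i j)) ≈⟨ sum-cong-≋ (λ i → sum-cong-≋ λ j → x∙yz≈y∙xz (a i) (b j) (f i j)) ⟩
    (sum λ i → sum λ j → b j ⊛ (a i ⊛ f i j)) ≈⟨ ∑-comm (λ i j → b j ⊛ (a i ⊛ f i j)) ⟩
    (sum λ j → sum λ i → b j ⊛ (a i ⊛ f i j)) ≈⟨ sum-cong-≋ (λ j → *-distribˡ-sum (b j) (λ i → a i ⊛ f i j)) ⟨
    (sum λ j → b j ⊛ sum λ i → a i ⊛ f i j)   ∎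
    where open import Algebra.Properties.CommutativeSemigroup *-commutativeSemigroup using (x∙yz≈y∙xz)

module ℤSum = Sum ℤₚ.+-*-commutativeRing
open ℤSum using (sum-single; sum-*-comm; sum-cong-≗)

sum-++ : ∀ {k l} (h : ℤ → ℤ → ℤ) (u u′ : Vector ℤ k) (v v′ : Vector ℤ l) →
         sumℤ (λ j → h ((u ++ v) j) ((u′ ++ v′) j)) ≡
         sumℤ (λ j → h (u j) (u′ j)) + sumℤ (λ j → h (v j) (v′ j))
sum-++ {zero}  h u u′ v v′ = ≡.sym (ℤₚ.+-identityˡ _)
sum-++ {suc k} h u u′ v v′ = begin
  h (u zero) (u′ zero) + sumℤ (λ j → h ((u ++ v) (suc j)) ((u′ ++ v′) (suc j)))
    ≡⟨ cong (_+_ (h (u zero) (u′ zero))) (sum-cong-≗ λ j → cong₂ h (++-suc u v j) (++-suc u′ v′ j)) ⟩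
  h (u zero) (u′ zero) + sumℤ (λ j → h (((u ∘ suc) ++ v) j) (((u′ ∘ suc) ++ v′) j))
    ≡⟨ cong (_+_ (h (u zero) (u′ zero))) (sum-++ h (u ∘ suc) (u′ ∘ suc) v v′) ⟩
  h (u zero) (u′ zero) + (sumℤ (λ j → h (u (suc j)) (u′ (suc j))) + sumℤ (λ j → h (v j) (v′ j)))
    ≡⟨ ℤₚ.+-assoc (h (u zero) (u′ zero)) _ _ ⟨
  sumℤ (λ j → h (u j) (u′ j)) + sumℤ (λ j → h (v j) (v′ j)) ∎
  where
  open ≡-Reasoning
  -- Concatenation is defined through `splitAt`, which at a successor is stuck until its value at
  -- the predecessor is known.
  ++-suc : ∀ {k l} (u : Vector ℤ (suc k)) (v : Vector ℤ l) j → (u ++ v) (suc j) ≡ ((u ∘ suc) ++ v) j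
  ++-suc {k} u v j with splitAt k j
  ... | inj₁ _ = refl
  ... | inj₂ _ = refl

-- Integer indicators of decidable propositions and sums over subsets

-- Branching on `does` makes the entries of `I` and of `incidenceMatrix` instances of this indicator
-- by definition.
⟦_⟧ : Dec P → ℤ
⟦ P? ⟧ = if does P? then 1ℤ else 0ℤ

⟦⟧-cong : P ⇔ Q → (P? : Dec P) (Q? : Dec Q) → ⟦ P? ⟧ ≡ ⟦ Q? ⟧
⟦⟧-cong P⇔Q P? Q? = cong (if_then 1ℤ else 0ℤ) (does-⇔ P⇔Q P? Q?)

⟦⟧-true : (P? : Dec P) → P → ⟦ P? ⟧ ≡ 1ℤ
⟦⟧-true P? p = cong (if_then 1ℤ else 0ℤ) (dec-true P? p)

⟦⟧-true⁻¹ : (P? : Dec P) → ⟦ P? ⟧ ≡ 1ℤ → P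
⟦⟧-true⁻¹ (yes p) _ = p

⟦⟧-false : (P? : Dec P) → ¬ P → ⟦ P? ⟧ ≡ 0ℤ
⟦⟧-false P? ¬p = cong (if_then 1ℤ else 0ℤ) (dec-false P? ¬p)

⟦⟧-× : (P? : Dec P) (Q? : Dec Q) → ⟦ P? ×-dec Q? ⟧ ≡ ⟦ P? ⟧ * ⟦ Q? ⟧
⟦⟧-× P? Q? with does P? | does Q?
... | false | _     = refl
... | true  | false = refl
... | true  | true  = refl

⟦⟧-*-cong : (P? : Dec P) {x y : ℤ} → (P → x ≡ y) → ⟦ P? ⟧ * x ≡ ⟦ P? ⟧ * y
⟦⟧-*-cong (yes p) x≡y = cong (1ℤ *_) (x≡y p)
⟦⟧-*-cong (no _)  _   = refl

if-⟦⟧ : (P? : Dec P) (x : ℤ) → (if does P? then x else 0ℤ) ≡ ⟦ P? ⟧ * x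
if-⟦⟧ P? x with does P?
... | true  = ≡.sym (ℤₚ.*-identityˡ x)
... | false = refl

sum-⟦≟⟧ : (i : Fin n) (f : Vector ℤ n) → sumℤ (λ j → ⟦ i ≟ j ⟧ * f j) ≡ f i
sum-⟦≟⟧ i f = ≡.trans
  (sum-single i _ λ j i≢j → cong (_* f j) (⟦⟧-false (i ≟ j) i≢j))
  (≡.trans (cong (_* f i) (⟦⟧-true (i ≟ i) refl)) (ℤₚ.*-identityˡ (f i)))

sum-count : ∀ {a} {A : Set a} {P : Pred A p} (P? : Decidable P) (xs : Vec A n) →
            sumℤ (λ j → ⟦ P? (lookup xs j) ⟧) ≡ + count P? xs
sum-count P? []       = refl
sum-count P? (x ∷ xs) with does (P? x)
... | true  = cong (_+_ 1ℤ) (sum-count P? xs)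
... | false = ≡.trans (ℤₚ.+-identityˡ _) (sum-count P? xs)

sum-∈ : (S : Subset n) → sumℤ (λ x → ⟦ x ∈? S ⟧) ≡ + ∣ S ∣
sum-∈ S = ≡.trans
  -- `∣ S ∣` is defined as the count of the entries `inside`, so membership is first read as a
  -- lookup.
  (sum-cong-≗ λ x → ⟦⟧-cong (mk⇔ []=⇒lookup (lookup⇒[]= x S)) (x ∈? S) (lookup S x ≟ᵇ inside))
  (sum-count (_≟ᵇ inside) S)

sumOver : Subset n → Vector ℤ n → ℤ
sumOver S f = sumℤ λ x → ⟦ x ∈? S ⟧ * f x

sumOver-const : (S : Subset n) {f : Vector ℤ n} {y : ℤ} → (∀ {x} → x ∈ S → f x ≡ y) →
                sumOver S f ≡ + ∣ S ∣ * y
sumOver-const S {f} {y} f≡y = begin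
  (sumℤ λ x → ⟦ x ∈? S ⟧ * f x) ≡⟨ sum-cong-≗ (λ x → ⟦⟧-*-cong (x ∈? S) f≡y) ⟩
  (sumℤ λ x → ⟦ x ∈? S ⟧ * y)   ≡⟨ ℤSum.*-distribʳ-sum y (λ x → ⟦ x ∈? S ⟧) ⟨
  (sumℤ λ x → ⟦ x ∈? S ⟧) * y   ≡⟨ cong (_* y) (sum-∈ S) ⟩
  + ∣ S ∣ * y                   ∎
  where open ≡-Reasoning

sumOver-permute : (π : Permutation′ n) (S : Subset n) → (∀ x → x ∈ S ⇔ (π ⟨$⟩ʳ x) ∈ S) →
                  {f h : Vector ℤ n} → (∀ x → f x ≡ h (π ⟨$⟩ʳ x)) → sumOver S f ≡ sumOver S h
sumOver-permute π S inv {f} {h} f≡hπ = ≡.trans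
  (sum-cong-≗ λ x → cong₂ _*_ (⟦⟧-cong (inv x) (x ∈? S) ((π ⟨$⟩ʳ x) ∈? S)) (f≡hπ x))
  (≡.sym (ℤSum.sum-permute (λ x → ⟦ x ∈? S ⟧ * h x) π))

-- Orbits

module _ {_↝_ : Rel (Fin n) g} (↝-equiv : IsEquivalence _↝_) (orbits : Orbits _↝_ t) where

  private
    module E = IsEquivalence ↝-equiv
    module O = Orbits orbits

  rep∈orbit : ∀ i → rep orbits i ∈ orbit orbits i
  rep∈orbit i = Equivalence.from (O.orbit-of i _) E.refl

  orbit-closed : ∀ {i x y} → x ↝ y → x ∈ orbit orbits i ⇔ y ∈ orbit orbits i
  orbit-closed {i} {x} {y} x↝y = mk⇔ (move x↝y) (move (E.sym x↝y))
    where
    move : ∀ {x y} → x ↝ y → x ∈ orbit orbits i → y ∈ orbit orbits i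
    move x↝y x∈ = Equivalence.from (O.orbit-of i _) (E.trans (Equivalence.to (O.orbit-of i _) x∈) x↝y)

  -- Two orbits with a common point have the same elements, since every element of either is
  -- connected to that point. `distinct` then turns equality of subsets into equality of indices.
  orbit-unique : ∀ {i j x} → x ∈ orbit orbits i → x ∈ orbit orbits j → i ≡ j
  orbit-unique {i} {j} x∈i x∈j = O.distinct (⊆-antisym (⊆ x∈i x∈j) (⊆ x∈j x∈i))
    where
    ⊆ : ∀ {i j x y} → x ∈ orbit orbits i → x ∈ orbit orbits j → y ∈ orbit orbits i → y ∈ orbit orbits j
    ⊆ {i} {j} x∈i x∈j y∈i = Equivalence.to (orbit-closed (E.trans
      (E.sym (Equivalence.to (O.orbit-of i _) x∈i)) (Equivalence.to (O.orbit-of i _) y∈i))) x∈j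

  sum-orbits : ∀ x → sumℤ (λ i → ⟦ x ∈? orbit orbits i ⟧) ≡ 1ℤ
  sum-orbits x with O.cover x
  ... | i , x∈i = ≡.trans
    (sum-single i _ λ j i≢j → ⟦⟧-false (x ∈? orbit orbits j) (i≢j ∘ orbit-unique x∈i))
    (⟦⟧-true (x ∈? orbit orbits i) x∈i)

  -- Removing the representative strictly lowers the size. This is what later allows the common
  -- orbit length to be cancelled.
  ∣orbit∣-nonZero : ∀ i → ℕ.NonZero ∣ orbit orbits i ∣
  ∣orbit∣-nonZero i = ℕ.>-nonZero (ℕₚ.≤-<-trans ℕ.z≤n (x∈p⇒∣p-x∣<∣p∣ (rep∈orbit i)))

-- Permutation automorphisms

module _ {σ : Permutation′ n} {P : Matrix ℤ n n} (P≋σ : P ≋ λ i j → I n (σ ⟨$⟩ʳ i) j) where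

  permutation-entry : ∀ i → P i (σ ⟨$⟩ʳ i) ≡ 1ℤ
  permutation-entry i = ≡.trans (P≋σ i _) (⟦⟧-true ((σ ⟨$⟩ʳ i) ≟ _) refl)

  permutation-entry⁻¹ : ∀ {i j} → P i j ≡ 1ℤ → σ ⟨$⟩ʳ i ≡ j
  permutation-entry⁻¹ {i} {j} Pij≡1 = ⟦⟧-true⁻¹ ((σ ⟨$⟩ʳ i) ≟ j) (≡.trans (≡.sym (P≋σ i j)) Pij≡1)

  permutation-⊗ : ∀ {l} (M : Matrix ℤ n l) i j → (P ⊗ M) i j ≡ M (σ ⟨$⟩ʳ i) j
  permutation-⊗ M i j = ≡.trans
    (sum-cong-≗ λ k → cong (_* M k j) (P≋σ i k))
    (sum-⟦≟⟧ (σ ⟨$⟩ʳ i) λ k → M k j)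

  ⊗-permutation : ∀ {l} (M : Matrix ℤ l n) i j → (M ⊗ P ᵀ) i j ≡ M i (σ ⟨$⟩ʳ j)
  ⊗-permutation M i j = ≡.trans
    (sum-cong-≗ λ k → ℤₚ.*-comm (M i k) (P j k))
    (permutation-⊗ (M ᵀ) j i)

module _ {W : Matrix ℤ n n} {G : Matrix ℤ n n → Matrix ℤ n n → Set g}
         (group : IsPermutationAutomorphismGroup W G) where

  open IsPermutationAutomorphismGroup group

  RowMove-isEquivalence : IsEquivalence (RowMove G)
  RowMove-isEquivalence = record
    { refl  = λ {x} → I _ , I _ , identity , ⟦⟧-true (x ≟ x) refl
    ; sym   = λ (P , Q , G-PQ , Pyx) → P ᵀ , Q ᵀ , inverse G-PQ , Pyx
    ; trans = λ (P , Q , G-PQ , Pyx) (P′ , Q′ , G-PQ′ , Pzy) →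
        let σ , P≋σ = IsPermutationAutomorphism.isPermutationˡ (automorphism G-PQ′)
        -- The second move multiplies on the left. Row `z` of `P′ ⊗ P` is row `σ z` of `P`, and the
        -- entry 1 of `P′` at `(z, y)` says that `σ z` is `y`.
        in P′ ⊗ P , Q′ ⊗ Q , product G-PQ′ G-PQ ,
           ≡.trans (permutation-⊗ {σ = σ} P≋σ P _ _)
                   (subst (λ y → P y _ ≡ 1ℤ) (≡.sym (permutation-entry⁻¹ {σ = σ} P≋σ Pzy)) Pyx)
    }

  ColumnMove-isEquivalence : IsEquivalence (ColumnMove G)
  ColumnMove-isEquivalence = record
    { refl  = λ {x} → I _ , I _ , identity , ⟦⟧-true (x ≟ x) refl
    ; sym   = λ (P , Q , G-PQ , Qyx) → P ᵀ , Q ᵀ , inverse G-PQ , Qyx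
    ; trans = λ (P , Q , G-PQ , Qyx) (P′ , Q′ , G-PQ′ , Qzy) →
        let τ , Q≋τ = IsPermutationAutomorphism.isPermutationʳ (automorphism G-PQ′)
        in P′ ⊗ P , Q′ ⊗ Q , product G-PQ′ G-PQ ,
           ≡.trans (permutation-⊗ {σ = τ} Q≋τ Q _ _)
                   (subst (λ y → Q y _ ≡ 1ℤ) (≡.sym (permutation-entry⁻¹ {σ = τ} Q≋τ Qzy)) Qyx)
    }

  -- The index form of an element of `G`: with it, invariance of orbit sums becomes a reindexing and
  -- needs no matrix products.
  record IsMove (σ τ : Permutation′ n) : Set g where
    field
      row       : ∀ x → RowMove G x (σ ⟨$⟩ʳ x)
      column    : ∀ y → ColumnMove G y (τ ⟨$⟩ʳ y)
      invariant : ∀ x y → W x y ≡ W (σ ⟨$⟩ʳ x) (τ ⟨$⟩ʳ y)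

  isMove : ∀ {P Q} → (G-PQ : G P Q) →
           IsMove (proj₁ (IsPermutationAutomorphism.isPermutationˡ (automorphism G-PQ)))
                  (proj₁ (IsPermutationAutomorphism.isPermutationʳ (automorphism G-PQ)))
  isMove {P} {Q} G-PQ = record
    -- The entry of `P` at `(x, σ x)` is 1, so `P` moves `σ x` to `x`; the opposite move is made by
    -- the transpose.
    { row       = λ x → P ᵀ , Q ᵀ , inverse G-PQ , permutation-entry {σ = σ} P≋σ x
    ; column    = λ y → P ᵀ , Q ᵀ , inverse G-PQ , permutation-entry {σ = τ} Q≋τ y
    ; invariant = λ x y → ≡.trans (≡.sym (preserves x y))
        (≡.trans (⊗-permutation {σ = τ} Q≋τ (P ⊗ W) x y) (permutation-⊗ {σ = σ} P≋σ W x (τ ⟨$⟩ʳ y)))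
    }
    where
    open IsPermutationAutomorphism (automorphism G-PQ)
    σ = proj₁ isPermutationˡ
    P≋σ = proj₂ isPermutationˡ
    τ = proj₁ isPermutationʳ
    Q≋τ = proj₂ isPermutationʳ

  -- The group element that moves `x` to `x′` also permutes each column orbit within itself, so on
  -- that orbit row `x′` is a rearrangement of row `x`.
  rowSum-const : (columns : Orbits (ColumnMove G) t) → ∀ {x x′} → RowMove G x x′ → ∀ j →
                 sumOver (orbit columns j) (W x′) ≡ sumOver (orbit columns j) (W x)
  rowSum-const columns {x} {x′} (P , Q , G-PQ , Px′x) j =
    sumOver-permute τ (orbit columns j) (λ y → orbit-closed ColumnMove-isEquivalence columns (column y))
      λ y → ≡.trans (invariant x′ y) (cong (λ x → W x (τ ⟨$⟩ʳ y)) (permutation-entry⁻¹ {σ = σ} P≋σ Px′x))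
    where
    open IsMove (isMove G-PQ)
    open IsPermutationAutomorphism (automorphism G-PQ)
    σ = proj₁ isPermutationˡ
    P≋σ = proj₂ isPermutationˡ
    τ = proj₁ isPermutationʳ

  columnSum-const : (rows : Orbits (RowMove G) t) → ∀ {y y′} → ColumnMove G y y′ → ∀ i →
                    sumOver (orbit rows i) (λ x → W x y′) ≡ sumOver (orbit rows i) (λ x → W x y)
  columnSum-const rows {y} {y′} (P , Q , G-PQ , Qy′y) i =
    sumOver-permute σ (orbit rows i) (λ x → orbit-closed RowMove-isEquivalence rows (row x))
      λ x → ≡.trans (invariant x y′) (cong (W (σ ⟨$⟩ʳ x)) (permutation-entry⁻¹ {σ = τ} Q≋τ Qy′y))
    where
    open IsMove (isMove G-PQ)
    open IsPermutationAutomorphism (automorphism G-PQ)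
    σ = proj₁ isPermutationˡ
    τ = proj₁ isPermutationʳ
    Q≋τ = proj₂ isPermutationʳ

  -- Double counting in the blocks and the Gram matrix of the row orbit matrix

  module _ (rows : Orbits (RowMove G) t) (columns : Orbits (ColumnMove G) t) {len : ℕ}
           (∣rows∣ : ∀ i → ∣ orbit rows i ∣ ≡ len) (∣columns∣ : ∀ j → ∣ orbit columns j ∣ ≡ len) where

    private
      open ≡-Reasoning

      R : Matrix ℤ t t
      R = rowOrbitMatrix W rows columns

      R≡sumOver : ∀ i j → R i j ≡ sumOver (orbit columns j) (W (rep rows i))
      R≡sumOver i j = sum-cong-≗ λ y → if-⟦⟧ (y ∈? orbit columns j) (W (rep rows i) y)

    -- Both sides are the total of the block of `W` on row orbit `k` and column orbit `j`, taken by
    -- rows and by columns. Equal orbit lengths put the same factor on each side.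
    len-*-rowSum≡len-*-columnSum : ∀ k j → + len * R k j ≡
      + len * sumOver (orbit rows k) (λ x → W x (rep columns j))
    len-*-rowSum≡len-*-columnSum k j = begin
      + len * R k j
        ≡⟨ cong₂ (λ l x → + l * x) (≡.sym (∣rows∣ k)) (R≡sumOver k j) ⟩
      + ∣ orbit rows k ∣ * sumOver (orbit columns j) (W (rep rows k))
        ≡⟨ (sumOver-const (orbit rows k) λ x∈ →
             rowSum-const columns (Equivalence.to (Orbits.orbit-of rows k _) x∈) j) ⟨
      sumOver (orbit rows k) (λ x → sumOver (orbit columns j) (W x))
        ≡⟨ sum-*-comm (λ x → ⟦ x ∈? orbit rows k ⟧) (λ y → ⟦ y ∈? orbit columns j ⟧) W ⟩
      sumOver (orbit columns j) (λ y → sumOver (orbit rows k) (λ x → W x y))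
        ≡⟨ (sumOver-const (orbit columns j) λ y∈ →
             columnSum-const rows (Equivalence.to (Orbits.orbit-of columns j _) y∈) k) ⟩
      + ∣ orbit columns j ∣ * sumOver (orbit rows k) (λ x → W x (rep columns j))
        ≡⟨ cong (λ l → + l * sumOver (orbit rows k) (λ x → W x (rep columns j))) (∣columns∣ j) ⟩
      + len * sumOver (orbit rows k) (λ x → W x (rep columns j)) ∎

    -- Cancelling `len` in the double count settles the representative column, and `columnSum-const`
    -- carries the value to every column of the orbit.
    columnSum≡rowOrbitMatrix : ∀ k j {y} → y ∈ orbit columns j →
                               sumOver (orbit rows k) (λ x → W x y) ≡ R k j
    columnSum≡rowOrbitMatrix k j {y} y∈ = begin
      sumOver (orbit rows k) (λ x → W x y)
        ≡⟨ columnSum-const rows (Equivalence.to (Orbits.orbit-of columns j _) y∈) k ⟩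
      sumOver (orbit rows k) (λ x → W x (rep columns j))
        ≡⟨ ℤₚ.*-cancelˡ-≡ (+ len) _ _ {{len≢0}} (len-*-rowSum≡len-*-columnSum k j) ⟨
      R k j ∎
      where
      len≢0 : ℕ.NonZero len
      -- The index `k` supplies a row orbit of this length, and its representative makes it
      -- nonempty.
      len≢0 = subst ℕ.NonZero (∣rows∣ k) (∣orbit∣-nonZero RowMove-isEquivalence rows k)

    -- Only `R i j` is expanded as a row sum; `R k j` is read as a column sum over row orbit `k`.
    -- The product becomes the sum of the inner products of row `rep rows i` with the rows of orbit
    -- `k`, and orthogonality leaves at most one of them, equal to `m`.
    rowOrbitMatrix-gram : ∀ {m} → IsWeighingMatrix W m → R ⊗ R ᵀ ≋ λ i k → + m * I t i k
    rowOrbitMatrix-gram {m} weighing i k = begin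
      (sumℤ λ j → R i j * R k j)
        ≡⟨ sum-cong-≗ (λ j → ≡.trans (ℤₚ.*-comm (R i j) (R k j)) (cong (R k j *_) (R≡sumOver i j))) ⟩
      (sumℤ λ j → R k j * sumℤ λ y → ⟦ y ∈? orbit columns j ⟧ * w y)
        ≡⟨ sum-cong-≗ (λ j → cong (R k j *_) (sum-cong-≗ λ y → ℤₚ.*-comm ⟦ y ∈? orbit columns j ⟧ (w y))) ⟩
      (sumℤ λ j → R k j * sumℤ λ y → w y * ⟦ y ∈? orbit columns j ⟧)
        ≡⟨ sum-*-comm (R k) w (λ j y → ⟦ y ∈? orbit columns j ⟧) ⟩
      (sumℤ λ y → w y * sumℤ λ j → R k j * ⟦ y ∈? orbit columns j ⟧)
        ≡⟨ sum-cong-≗ (λ y → cong (w y *_) (step y)) ⟩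
      (sumℤ λ y → w y * sumOver (orbit rows k) (λ x → W x y))
        ≡⟨ sum-*-comm w (λ x → ⟦ x ∈? orbit rows k ⟧) (λ y x → W x y) ⟩
      (sumℤ λ x → ⟦ x ∈? orbit rows k ⟧ * sumℤ λ y → w y * W x y)
        ≡⟨ sum-cong-≗ (λ x → cong (⟦ x ∈? orbit rows k ⟧ *_)
             (IsWeighingMatrix.orthogonal weighing (rep rows i) x)) ⟩
      (sumℤ λ x → ⟦ x ∈? orbit rows k ⟧ * (+ m * ⟦ rep rows i ≟ x ⟧))
        ≡⟨ sum-cong-≗ (λ x → solve 3 (λ a b c → a :* (b :* c) := c :* (b :* a)) refl
                                   ⟦ x ∈? orbit rows k ⟧ (+ m) ⟦ rep rows i ≟ x ⟧) ⟩
      (sumℤ λ x → ⟦ rep rows i ≟ x ⟧ * (+ m * ⟦ x ∈? orbit rows k ⟧))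
        ≡⟨ sum-⟦≟⟧ (rep rows i) (λ x → + m * ⟦ x ∈? orbit rows k ⟧) ⟩
      + m * ⟦ rep rows i ∈? orbit rows k ⟧
        -- Orbits are disjoint, so the representative of orbit `i` lies in orbit `k` exactly when
        -- the indices agree.
        ≡⟨ cong (+ m *_) (⟦⟧-cong (mk⇔
             (orbit-unique RowMove-isEquivalence rows (rep∈orbit RowMove-isEquivalence rows i))
             (λ { refl → rep∈orbit RowMove-isEquivalence rows i }))
             (rep rows i ∈? orbit rows k) (i ≟ k)) ⟩
      + m * I t i k ∎
      where
      open +-*-Solver using (solve; _:*_; _:=_)
      w : Vector ℤ n
      w = W (rep rows i)
      -- On the column orbit through `y` the entry `R k j` is the column sum `Δ` at `y`, which does
      -- not depend on `j`; exactly one orbit contains `y`.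
      step : ∀ y → sumℤ (λ j → R k j * ⟦ y ∈? orbit columns j ⟧) ≡ sumOver (orbit rows k) (λ x → W x y)
      step y = begin
        (sumℤ λ j → R k j * ⟦ y ∈? orbit columns j ⟧)
          ≡⟨ sum-cong-≗ (λ j → ≡.trans (ℤₚ.*-comm (R k j) ⟦ y ∈? orbit columns j ⟧)
               (⟦⟧-*-cong (y ∈? orbit columns j) (≡.sym ∘ columnSum≡rowOrbitMatrix k j))) ⟩
        (sumℤ λ j → ⟦ y ∈? orbit columns j ⟧ * Δ)
          ≡⟨ ℤSum.*-distribʳ-sum Δ (λ j → ⟦ y ∈? orbit columns j ⟧) ⟨
        (sumℤ λ j → ⟦ y ∈? orbit columns j ⟧) * Δ
          ≡⟨ cong (_* Δ) (sum-orbits ColumnMove-isEquivalence columns y) ⟩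
        1ℤ * Δ
          ≡⟨ ℤₚ.*-identityˡ Δ ⟩
        Δ ∎
        where
        Δ = sumOver (orbit rows k) (λ x → W x y)

-- The Gram matrix of a design

-- A product of two incidences is the indicator of a joint incidence, so each entry counts the
-- blocks through both points: `r` on the diagonal and `lam` off it.
incidenceMatrix-gram : ∀ {b r lam} {blocks : Vec (Subset t) b} → IsDesign blocks r lam →
  incidenceMatrix blocks ⊗ incidenceMatrix blocks ᵀ ≋ λ i k → (+ r - + lam) * I t i k + + lam
incidenceMatrix-gram {t} {b} {r} {lam} {blocks} design i k = ≡.trans
  (sum-cong-≗ λ j → ≡.sym (⟦⟧-× (i ∈? lookup blocks j) (k ∈? lookup blocks j)))
  (≡.trans (sum-count (λ β → (i ∈? β) ×-dec (k ∈? β)) blocks) (case (i ≟ k)))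
  where
  open IsDesign design
  open ≡-Reasoning
  open +-*-Solver using (solve; _:+_; _:*_; _:-_; _:=_; con)
  -- The decision is an argument, so that splitting on it also evaluates the entry of the identity
  -- matrix.
  case : (i≟k : Dec (i ≡ k)) → + count (λ β → (i ∈? β) ×-dec (k ∈? β)) blocks ≡
                               (+ r - + lam) * ⟦ i≟k ⟧ + + lam
  case (yes refl) = begin
    + count (λ β → (i ∈? β) ×-dec (i ∈? β)) blocks
      ≡⟨ sum-count (λ β → (i ∈? β) ×-dec (i ∈? β)) blocks ⟨
    (sumℤ λ j → ⟦ (i ∈? lookup blocks j) ×-dec (i ∈? lookup blocks j) ⟧)
      ≡⟨ sum-cong-≗ (λ j → ⟦⟧-cong (mk⇔ proj₁ λ i∈ → i∈ , i∈)
           ((i ∈? lookup blocks j) ×-dec (i ∈? lookup blocks j)) (i ∈? lookup blocks j)) ⟩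
    (sumℤ λ j → ⟦ i ∈? lookup blocks j ⟧)
      ≡⟨ sum-count (i ∈?_) blocks ⟩
    + count (i ∈?_) blocks
      ≡⟨ cong +_ (replication i) ⟩
    + r
      ≡⟨ solve 2 (λ r l → r := (r :- l) :* con 1ℤ :+ l) refl (+ r) (+ lam) ⟩
    (+ r - + lam) * 1ℤ + + lam ∎
  case (no i≢k) = begin
    + count (λ β → (i ∈? β) ×-dec (k ∈? β)) blocks
      ≡⟨ cong +_ (balance i≢k) ⟩
    + lam
      ≡⟨ solve 2 (λ r l → l := (r :- l) :* con 0ℤ :+ l) refl (+ r) (+ lam) ⟩
    (+ r - + lam) * 0ℤ + + lam ∎

-- Reduction of integers into a commutative ring

module FromℤProperties {c ℓ} (F : CommutativeRing c ℓ) where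

  open CommutativeRing F
    renaming ( _+_ to _⊕_; _*_ to _⊛_; -_ to ⊝_; _-_ to _⊖′_
             ; refl to ≈-refl; sym to ≈-sym; trans to ≈-trans; zero to *-zero )
  open Coding F
  open AbelianGroupProperties +-abelianGroup using (⁻¹-∙-comm; ⁻¹-involutive; ε⁻¹≈ε)
  open RingProperties ring using (-‿distribˡ-*; -‿distribʳ-*)
  open SemiringMult semiring using (×-homo-+; ×1-homo-*) renaming (_×_ to _·_)
  open Sum F using (sum)
  open SetoidReasoning setoid

  -- Integer addition with mixed signs computes by `⊖`. In the inductive step `1# - 1#` is inserted
  -- and its two halves are absorbed into the two multiples of `1#`.
  fromℤ-⊖ : ∀ m n → fromℤ (m ⊖ n) ≈ m · 1# ⊖′ n · 1#
  fromℤ-⊖ m       zero    = ≈-sym (≈-trans (+-congˡ ε⁻¹≈ε) (+-identityʳ _))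
  fromℤ-⊖ zero    (suc n) = ≈-sym (+-identityˡ _)
  fromℤ-⊖ (suc m) (suc n) = begin
    fromℤ (suc m ⊖ suc n)                      ≡⟨ cong fromℤ (ℤₚ.[1+m]⊖[1+n]≡m⊖n m n) ⟩
    fromℤ (m ⊖ n)                              ≈⟨ fromℤ-⊖ m n ⟩
    x ⊖′ y                                     ≈⟨ +-identityˡ _ ⟨
    0# ⊕ (x ⊖′ y)                              ≈⟨ +-congʳ (-‿inverseʳ 1#) ⟨
    (1# ⊖′ 1#) ⊕ (x ⊖′ y)                      ≈⟨ interchange 1# (⊝ 1#) x (⊝ y) ⟩
    (1# ⊕ x) ⊕ (⊝ 1# ⊕ ⊝ y)                    ≈⟨ +-congˡ (⁻¹-∙-comm 1# y) ⟩
    suc m · 1# ⊖′ suc n · 1#                   ∎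
    where
    x = m · 1#
    y = n · 1#
    open import Algebra.Properties.CommutativeSemigroup +-commutativeSemigroup using (interchange)

  fromℤ-+ : ∀ i j → fromℤ (i + j) ≈ fromℤ i ⊕ fromℤ j
  fromℤ-+ (+ m)    (+ n)    = ×-homo-+ 1# m n
  fromℤ-+ (+ m)    -[1+ n ] = fromℤ-⊖ m (suc n)
  fromℤ-+ -[1+ m ] (+ n)    = ≈-trans (fromℤ-⊖ n (suc m)) (+-comm _ _)
  fromℤ-+ -[1+ m ] -[1+ n ] = begin
    ⊝ (suc (suc (m ℕ.+ n)) · 1#)      ≡⟨ cong (λ k → ⊝ (suc k · 1#)) (ℕₚ.+-suc m n) ⟨
    ⊝ ((suc m ℕ.+ suc n) · 1#)        ≈⟨ -‿cong (×-homo-+ 1# (suc m) (suc n)) ⟩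
    ⊝ (suc m · 1# ⊕ suc n · 1#)       ≈⟨ ⁻¹-∙-comm _ _ ⟨
    ⊝ (suc m · 1#) ⊕ ⊝ (suc n · 1#)   ∎

  fromℤ-neg : ∀ i → fromℤ (- i) ≈ ⊝ fromℤ i
  fromℤ-neg (+ zero)  = ≈-sym ε⁻¹≈ε
  fromℤ-neg (+ suc n) = ≈-refl
  fromℤ-neg -[1+ n ]  = ≈-sym (⁻¹-involutive _)

  fromℤ-pos-* : ∀ m j → fromℤ (+ m * j) ≈ fromℤ (+ m) ⊛ fromℤ j
  fromℤ-pos-* m (+ n) = begin
    fromℤ (+ m * + n)            ≡⟨ cong fromℤ (ℤₚ.pos-* m n) ⟨
    (m ℕ.* n) · 1#               ≈⟨ ×1-homo-* m n ⟩
    (m · 1#) ⊛ (n · 1#)          ∎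
  fromℤ-pos-* m -[1+ n ] = begin
    fromℤ (+ m * - + suc n)      ≡⟨ cong fromℤ (ℤₚ.neg-distribʳ-* (+ m) (+ suc n)) ⟨
    fromℤ (- (+ m * + suc n))    ≈⟨ fromℤ-neg (+ m * + suc n) ⟩
    ⊝ fromℤ (+ m * + suc n)      ≡⟨ cong (⊝_ ∘ fromℤ) (ℤₚ.pos-* m (suc n)) ⟨
    ⊝ ((m ℕ.* suc n) · 1#)       ≈⟨ -‿cong (×1-homo-* m (suc n)) ⟩
    ⊝ (m · 1# ⊛ suc n · 1#)      ≈⟨ -‿distribʳ-* _ _ ⟩
    m · 1# ⊛ ⊝ (suc n · 1#)      ∎

  fromℤ-* : ∀ i j → fromℤ (i * j) ≈ fromℤ i ⊛ fromℤ j
  fromℤ-* (+ m)    j = fromℤ-pos-* m j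
  fromℤ-* -[1+ m ] j = begin
    fromℤ (- + suc m * j)        ≡⟨ cong fromℤ (ℤₚ.neg-distribˡ-* (+ suc m) j) ⟨
    fromℤ (- (+ suc m * j))      ≈⟨ fromℤ-neg (+ suc m * j) ⟩
    ⊝ fromℤ (+ suc m * j)        ≈⟨ -‿cong (fromℤ-pos-* (suc m) j) ⟩
    ⊝ (suc m · 1# ⊛ fromℤ j)     ≈⟨ -‿distribˡ-* _ _ ⟩
    ⊝ (suc m · 1#) ⊛ fromℤ j     ∎

  fromℤ-sum : (f : Vector ℤ n) → fromℤ (sumℤ f) ≈ sum (fromℤ ∘ f)
  fromℤ-sum {zero}  f = ≈-refl
  fromℤ-sum {suc n} f = ≈-trans (fromℤ-+ (f zero) (sumℤ (f ∘ suc))) (+-congˡ (fromℤ-sum (f ∘ suc)))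

-- Linear codes

module CodeProperties {c ℓ} (F : CommutativeRing c ℓ) where

  open CommutativeRing F
    renaming ( _+_ to _⊕_; _*_ to _⊛_; -_ to ⊝_; _-_ to _⊖′_
             ; refl to ≈-refl; sym to ≈-sym; trans to ≈-trans; zero to *-zero )
  open Coding F
  open FromℤProperties F
  open SemiringMult semiring using (×-assoc-*; ×-congʳ) renaming (_×_ to _·_)
  module FSum = Sum F
  open FSum hiding (sum-single; sum-*-comm; sum-cong-≗)
  open SetoidReasoning setoid

  -- The coefficients are row `i` of the identity matrix, so the membership proof is also the
  -- evaluation of a sum against a Kronecker delta.
  row∈generatedBy : ∀ {k N} (A : Matrix Carrier k N) i → Codeword (generatedBy A) (A i)
  row∈generatedBy {k} A i = (λ l → fromℤ (I k i l)) , λ j → ≈-sym (begin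
    (sum λ l → fromℤ (I k i l) ⊛ A l j)
      ≈⟨ FSum.sum-single i _ (λ l i≢l →
           ≈-trans (*-congʳ (reflexive (cong fromℤ (⟦⟧-false (i ≟ l) i≢l)))) (zeroˡ _)) ⟩
    fromℤ (I k i i) ⊛ A i j
      ≈⟨ *-congʳ (reflexive (cong fromℤ (⟦⟧-true (i ≟ i) refl))) ⟩
    (1# ⊕ 0#) ⊛ A i j
      -- `fromℤ 1ℤ` unfolds to `1# + 0#`, not to `1#`.
      ≈⟨ *-congʳ (+-identityʳ 1#) ⟩
    1# ⊛ A i j
      ≈⟨ *-identityˡ _ ⟩
    A i j ∎)

  -- Testing `v` against row `l` and expanding `v` through the coefficients `a` gives coordinate `l`
  -- of `a` times the Gram matrix.
  dual-gram : ∀ {k N} (A : Matrix Carrier k N) (a : Vector Carrier k) {v} →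
              (∀ j → v j ≈ sum λ i → a i ⊛ A i j) → Dual (generatedBy A) v →
              ∀ l → sum (λ i → a i ⊛ ⟨ A l , A i ⟩) ≈ 0#
  dual-gram A a {v} v≈aA v∈dual l = begin
    (sum λ i → a i ⊛ sum λ j → A l j ⊛ A i j)   ≈⟨ FSum.sum-*-comm a (A l) A ⟩
    (sum λ j → A l j ⊛ sum λ i → a i ⊛ A i j)   ≈⟨ sum-cong-≋ (λ j → *-congˡ (v≈aA j)) ⟨
    (sum λ j → A l j ⊛ v j)                     ≈⟨ v∈dual (A l) (row∈generatedBy A l) ⟩
    0#                                          ∎

  zero⇒code∩dual : ∀ {N p} (C : LinearCode N p) {v} → (∀ j → v j ≈ 0#) → Codeword C v × Dual C v
  zero⇒code∩dual C v≈0 =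
    LinearCode.respects C (≈-sym ∘ v≈0) (LinearCode.null C) ,
    λ u _ → sum-zero _ λ j → ≈-trans (*-congˡ (v≈0 j)) (zeroʳ (u j))

  -- Codes over a field whose Gram matrix combines the identity and the all-ones matrix

  module _ {q} (field′ : IsFiniteField F q) where

    open IsFiniteField field′ using (invertible)

    *-cancel-0 : ∀ {x y} → x ≉ 0# → x ⊛ y ≈ 0# → y ≈ 0#
    *-cancel-0 {x} {y} x≉0 xy≈0 with invertible x x≉0
    ... | x⁻¹ , xx⁻¹≈1 = begin
      y               ≈⟨ *-identityˡ y ⟨
      1# ⊛ y          ≈⟨ *-congʳ (≈-trans (*-comm x⁻¹ x) xx⁻¹≈1) ⟨
      (x⁻¹ ⊛ x) ⊛ y   ≈⟨ *-assoc x⁻¹ x y ⟩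
      x⁻¹ ⊛ (x ⊛ y)   ≈⟨ *-congˡ xy≈0 ⟩
      x⁻¹ ⊛ 0#        ≈⟨ zeroʳ x⁻¹ ⟩
      0#              ∎

    -- The matrix acts as `μ + t ν` on the all-ones vector and as `μ` on vectors of sum zero. The
    -- first value being nonzero forces `sum a` to vanish, and the second then forces each entry to
    -- vanish.
    μI+λJ-injective : ∀ (μ ν : Carrier) (a : Vector Carrier t) →
      μ ⊕ t · ν ≉ 0# → μ ≉ 0# → (∀ i → μ ⊛ a i ⊕ ν ⊛ sum a ≈ 0#) → ∀ i → a i ≈ 0#
    μI+λJ-injective {t} μ ν a μ+tν≉0 μ≉0 eq i = *-cancel-0 μ≉0 (begin
      μ ⊛ a i               ≈⟨ +-identityʳ _ ⟨
      μ ⊛ a i ⊕ 0#          ≈⟨ +-congˡ (≈-trans (*-congˡ s≈0) (zeroʳ ν)) ⟨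
      μ ⊛ a i ⊕ ν ⊛ sum a   ≈⟨ eq i ⟩
      0#                    ∎)
      where
      s≈0 : sum a ≈ 0#
      s≈0 = *-cancel-0 μ+tν≉0 (begin
        (μ ⊕ t · ν) ⊛ sum a                       ≈⟨ distribʳ (sum a) μ (t · ν) ⟩
        μ ⊛ sum a ⊕ (t · ν) ⊛ sum a               ≈⟨ +-cong (*-distribˡ-sum μ a) (×-assoc-* t ν (sum a)) ⟩
        sum (λ i → μ ⊛ a i) ⊕ t · (ν ⊛ sum a)     ≈⟨ +-congˡ (sum-replicate t) ⟨
        sum (λ i → μ ⊛ a i) ⊕ sum {t} (λ _ → ν ⊛ sum a) ≈⟨ ∑-distrib-+ (λ i → μ ⊛ a i) (λ _ → ν ⊛ sum a) ⟨
        sum (λ i → μ ⊛ a i ⊕ ν ⊛ sum a)           ≈⟨ sum-zero _ eq ⟩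
        0#                                        ∎)

    -- The coefficient vector of any codeword in the dual is annihilated by the Gram matrix, hence
    -- is zero itself; the codeword is zero as a consequence.
    gram⇒LCD : ∀ {N} (M : Matrix ℤ t N) (μ ν : ℤ) → M ⊗ M ᵀ ≋ (λ i k → μ * I t i k + ν) →
               fromℤ (μ + + t * ν) ≉ 0# → fromℤ μ ≉ 0# → LCD (generatedBy (fromℤ-matrix M))
    gram⇒LCD {t} M μ ν gram μ+tν≉0 μ≉0 v =
      mk⇔ (λ { ((a , v≈aA) , v∈dual) j → ≈-trans (v≈aA j)
              (sum-zero _ λ i → ≈-trans (*-congʳ (a≈0 a v≈aA v∈dual i)) (zeroˡ _)) })
          (zero⇒code∩dual (generatedBy A))
      where
      A = fromℤ-matrix M

      gram-A : ∀ l i → ⟨ A l , A i ⟩ ≈ fromℤ (I t l i) ⊛ fromℤ μ ⊕ fromℤ ν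
      gram-A l i = begin
        ⟨ A l , A i ⟩                            ≈⟨ sum-cong-≋ (λ j → fromℤ-* (M l j) (M i j)) ⟨
        sum (λ j → fromℤ (M l j * M i j))        ≈⟨ fromℤ-sum (λ j → M l j * M i j) ⟨
        fromℤ ((M ⊗ M ᵀ) l i)                    ≡⟨ cong fromℤ (gram l i) ⟩
        fromℤ (μ * I t l i + ν)                  ≈⟨ fromℤ-+ (μ * I t l i) ν ⟩
        fromℤ (μ * I t l i) ⊕ fromℤ ν            ≈⟨ +-congʳ (≈-trans (fromℤ-* μ (I t l i)) (*-comm _ _)) ⟩
        fromℤ (I t l i) ⊛ fromℤ μ ⊕ fromℤ ν      ∎

      module _ (a : Vector Carrier t) (v≈aA : ∀ j → v j ≈ sum λ i → a i ⊛ A i j)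
               (v∈dual : Dual (generatedBy A) v) where

        eq : ∀ l → fromℤ μ ⊛ a l ⊕ fromℤ ν ⊛ sum a ≈ 0#
        eq l = ≈-sym (begin
          0#
            ≈⟨ dual-gram A a v≈aA v∈dual l ⟨
          (sum λ i → a i ⊛ ⟨ A l , A i ⟩)
            ≈⟨ sum-cong-≋ (λ i → ≈-trans (*-congˡ (gram-A l i)) (≈-trans (*-comm _ _) (distribʳ (a i) _ _))) ⟩
          (sum λ i → fromℤ (I t l i) ⊛ fromℤ μ ⊛ a i ⊕ fromℤ ν ⊛ a i)
            ≈⟨ ∑-distrib-+ (λ i → fromℤ (I t l i) ⊛ fromℤ μ ⊛ a i) (λ i → fromℤ ν ⊛ a i) ⟩
          (sum λ i → fromℤ (I t l i) ⊛ fromℤ μ ⊛ a i) ⊕ (sum λ i → fromℤ ν ⊛ a i)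
            ≈⟨ +-cong (sum-cong-≋ {t} λ i → *-assoc (fromℤ (I t l i)) (fromℤ μ) (a i))
                      (≈-sym (*-distribˡ-sum (fromℤ ν) a)) ⟩
          (sum λ i → fromℤ (I t l i) ⊛ (fromℤ μ ⊛ a i)) ⊕ fromℤ ν ⊛ sum a
            -- The sum over i is row l of the one-column matrix (μ aᵢ).
            ≈⟨ +-congʳ (proj₂ (row∈generatedBy (λ i (_ : Fin 1) → fromℤ μ ⊛ a i) l) zero) ⟨
          fromℤ μ ⊛ a l ⊕ fromℤ ν ⊛ sum a ∎)

        a≈0 : ∀ i → a i ≈ 0#
        a≈0 = μI+λJ-injective (fromℤ μ) (fromℤ ν) a (μ+tν≉0 ∘ ≈-trans step) μ≉0 eq
          where
          -- The summation over `t` coordinates produces a `t`-fold sum, so the integer product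
          -- `+ t * ν` is rewritten as one.
          step : fromℤ (μ + + t * ν) ≈ fromℤ μ ⊕ t · fromℤ ν
          step = begin
            fromℤ (μ + + t * ν)                ≈⟨ fromℤ-+ μ (+ t * ν) ⟩
            fromℤ μ ⊕ fromℤ (+ t * ν)          ≈⟨ +-congˡ (fromℤ-* (+ t) ν) ⟩
            fromℤ μ ⊕ (t · 1#) ⊛ fromℤ ν       ≈⟨ +-congˡ (×-assoc-* t 1# (fromℤ ν)) ⟩
            fromℤ μ ⊕ t · (1# ⊛ fromℤ ν)       ≈⟨ +-congˡ (×-congʳ t (*-identityˡ (fromℤ ν))) ⟩
            fromℤ μ ⊕ t · fromℤ ν              ∎

-- The Gram matrix of the juxtaposition and its two eigenvalues

theorem4p6 : ∀ {c ℓ g} (F : CommutativeRing c ℓ) (q : ℕ) → IsFiniteField F q →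
    let open CommutativeRing F using (0#)
        open CommutativeRing F using (_≉_)
        open Coding F
    in
    (n m : ℕ) (W : Matrix ℤ n n) → IsWeighingMatrix W m →
    (G : Matrix ℤ n n → Matrix ℤ n n → Set g) → IsPermutationAutomorphismGroup W G →
    (t : ℕ) (rows : Orbits (RowMove G) t) (columns : Orbits (ColumnMove G) t) →
    (len : ℕ) → (∀ i → ∣ orbit rows i ∣ ≡ len) → (∀ j → ∣ orbit columns j ∣ ≡ len) →
    (b r lam : ℕ) (blocks : Vec (Subset t) b) → IsDesign blocks r lam →
    fromℤ (+ r + (+ t - + 1) * + lam + + m) ≉ 0# →
    fromℤ (+ r - + lam + + m) ≉ 0# →
    LCD (generatedBy (fromℤ-matrix (rowOrbitMatrix W rows columns ∣∣ incidenceMatrix blocks)))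
theorem4p6 F q field′ n m W weighing G group t rows columns len ∣rows∣ ∣columns∣ b r lam blocks design ≉0₁ ≉0₂ =
  CodeProperties.gram⇒LCD F field′ (R ∣∣ B) μ (+ lam) gram
    (subst (λ x → fromℤ x ≉ 0#) eigenvalue ≉0₁) ≉0₂
  where
  open CommutativeRing F using (0#; _≉_)
  open Coding F using (fromℤ)
  open +-*-Solver using (solve; _:+_; _:*_; _:-_; _:=_; con)
  R = rowOrbitMatrix W rows columns
  B = incidenceMatrix blocks
  μ = + r - + lam + + m
  gram : (R ∣∣ B) ⊗ (R ∣∣ B) ᵀ ≋ λ i k → μ * I t i k + + lam
  gram i k = begin
    ((R ∣∣ B) ⊗ (R ∣∣ B) ᵀ) i k
      -- The Gram matrix of a juxtaposition is the sum of the Gram matrices of its parts.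
      ≡⟨ sum-++ _*_ (R i) (R k) (B i) (B k) ⟩
    (R ⊗ R ᵀ) i k + (B ⊗ B ᵀ) i k
      ≡⟨ cong₂ _+_ (rowOrbitMatrix-gram group rows columns ∣rows∣ ∣columns∣ weighing i k)
                   (incidenceMatrix-gram design i k) ⟩
    + m * I t i k + ((+ r - + lam) * I t i k + + lam)
      ≡⟨ solve 4 (λ m r l δ → m :* δ :+ ((r :- l) :* δ :+ l) := (r :- l :+ m) :* δ :+ l)
               refl (+ m) (+ r) (+ lam) (I t i k) ⟩
    μ * I t i k + + lam ∎
    where open ≡-Reasoning
  -- The first nonvanishing hypothesis concerns the value at the all-ones vector. `+ t - + 1` is an
  -- integer difference, so the identity also covers `t` equal to zero.
  eigenvalue : + r + (+ t - + 1) * + lam + + m ≡ μ + + t * + lam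
  eigenvalue = solve 4 (λ m r l t → r :+ (t :- con 1ℤ) :* l :+ m := (r :- l :+ m) :+ t :* l)
                       refl (+ m) (+ r) (+ lam) (+ t)
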